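{- Let $t \geq 3$ be an integer, let $V$ be a finite set with $|V| = n$, and suppose that $\mathcal G_1, \ldots, \mathcal G_t \subset \binom{V}{2}$ are rainbow triangle-free (RBT-free). Then (i) or (ii) holds: (i) $t = 3$ and $|\mathcal G_1| + |\mathcal G_2| + |\mathcal G_3| \leq n(n-1)$; (ii) $t \geq 4$ and $|\mathcal G_1| + \ldots + |\mathcal G_t| \leq t \lfloor n^2/4 \rfloor$.
   Context: A graph on the vertex set $V$ is identified with its edge set, a subset of $\binom{V}{2}$ (the 2-element subsets of $V$), and $|\mathcal G|$ denotes the number of edges. A triangle is the set of three edges $\binom{T}{2}$ for some 3-element set $T \subset V$. Graphs $\mathcal G_1, \ldots, \mathcal G_t \subset \binom{V}{2}$ (not necessarily distinct or disjoint) are called rainbow triangle-free (RBT-free) if there do not exist indices $1 \leq i_1 < i_2 < i_3 \leq t$ and edges $E_1 \in \mathcal G_{i_1}$, $E_2 \in \mathcal G_{i_2}$, $E_3 \in \mathcal G_{i_3}$ such that $\{E_1, E_2, E_3\}$ is a triangle.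
   Formalization: The case t = 3, n = 2 is excluded, since there the claim fails: three copies of the single edge are rainbow triangle-free with total 3 > n(n-1) = 2. -}

module Defs where

open import Data.Nat using (ℕ)
open import Data.Nat.Properties using (+-0-commutativeMonoid)
open import Data.Fin using (Fin; _<_)
open import Data.Fin.Subset using (Subset; _⊆_; ∣_∣)
open import Data.List using (List; length)
open import Data.List.Membership.Propositional using (_∈_)
open import Data.List.Relation.Unary.All using (All)
open import Data.List.Relation.Unary.Unique.Propositional using (Unique)
open import Data.Product using (_×_; ∃-syntax)
open import Data.Sum using (_⊎_)
open import Function.Bundles using (_⇔_)
open import Relation.Binary.PropositionalEquality using (_≡_)
open import Relation.Nullary using (¬_)

open import Algebra.Properties.CommutativeMonoid.Sum +-0-commutativeMonoid public
  using (sum)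

-- The vertex set is Fin n. A graph is its set of edges, a finite set of
-- 2-element subsets of Fin n; a finite set is given by a duplicate-free list
-- of its elements, so that its cardinality is the length of the list.
record Graph (n : ℕ) : Set where
  field
    edges  : List (Subset n)
    unique : Unique edges
    pairs  : All (λ E → ∣ E ∣ ≡ 2) edges

open Graph public

infix 4 _∈ᴳ_

_∈ᴳ_ : ∀ {n} → Subset n → Graph n → Set
E ∈ᴳ 𝒢 = E ∈ edges 𝒢

size : ∀ {n} → Graph n → ℕ
size 𝒢 = length (edges 𝒢)

-- {E₁ , E₂ , E₃} = (T choose 2) for some 3-element set T, the equality of the
-- two sets of edges being expressed extensionally.
IsTriangle : ∀ {n} → Subset n → Subset n → Subset n → Set
IsTriangle {n} E₁ E₂ E₃ =
  ∃[ T ] ∣ T ∣ ≡ 3 ×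
    ((E : Subset n) → (E ≡ E₁ ⊎ E ≡ E₂ ⊎ E ≡ E₃) ⇔ (∣ E ∣ ≡ 2 × E ⊆ T))

RainbowTriangleFree : ∀ {n t} → (Fin t → Graph n) → Set
RainbowTriangleFree 𝒢 =
  ¬ (∃[ i₁ ] ∃[ i₂ ] ∃[ i₃ ] i₁ < i₂ × i₂ < i₃ ×
      (∃[ E₁ ] ∃[ E₂ ] ∃[ E₃ ]
        E₁ ∈ᴳ 𝒢 i₁ × E₂ ∈ᴳ 𝒢 i₂ × E₃ ∈ᴳ 𝒢 i₃ × IsTriangle E₁ E₂ E₃))

{-# OPTIONS --safe #-}
module Submission where

-- Give each pair of vertices x, y the set S(x, y) of indices i with {x, y} ∈ 𝒢ᵢ.
-- Three sets, one with at least three elements and the other two with more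
-- than t elements in total, have distinct representatives. So if
-- |S(u, v)| ≥ 3, then |S(u, x)| + |S(v, x)| ≤ t for every vertex x.
--
-- For t = 3 every triple of pairs therefore has total weight at most 6, and
-- averaging over all triples gives n (n - 1). For t ≥ 4, either all pairs have
-- weight at most 2, for a total of at most n (n - 1) ≤ 4 ⌊n²/4⌋, or there is
-- a pair u, v of weight at least 3; removing u and v loses at most
-- t + t (n - 2) = t ⌊n²/4⌋ - t ⌊(n - 2)²/4⌋, as in Mantel's theorem.

open import Defs
open import Data.Nat using (ℕ; _*_; _^_; _∸_; _/_; _≤_; _≥_)
open import Data.Fin using (Fin)
open import Data.Product using (_×_)
open import Data.Sum using (_⊎_)
open import Relation.Binary.PropositionalEquality using (_≡_; _≢_)

open import Algebra.Properties.CommutativeMonoid.Sum using (∑-distrib-+; sum-replicate-zero)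
open import Data.Bool using (if_then_else_; true; false)
import Data.Bool.Properties as Bool
open import Data.Empty using (⊥)
import Data.Fin as Fin
import Data.Fin.Properties as Fin
open import Data.Fin.Subset using (Subset; inside; outside; ⁅_⁆; _∪_; ∣_∣; _⊆_) renaming (⊥ to ∅; _∈_ to _∈ˢ_; _∉_ to _∉ˢ_)
open import Data.Fin.Subset.Properties using (∣⁅x⁆∣≡1; ∪-comm; ∪-idem; ∪-identityˡ; x∈p∪q⁺; x∈p∪q⁻; x∈⁅x⁆; x∈⁅y⁆⇒x≡y)
open import Data.List using (List; []; _∷_; _++_; length; map; filter; allFin; tabulate)
open import Data.List.Membership.Propositional using (_∈_; _∉_; find)
import Data.List.Membership.DecPropositional as DecMembership
open import Data.List.Membership.Propositional.Properties using (∈-∃++; ∈-++⁺ˡ; ∈-++⁺ʳ; ∈-map⁺; ∈-allFin; ∈-filter⁺; ∈-filter⁻)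
open import Data.List.Properties using (length-filter; length-tabulate; map-++; map-cong; map-∘; map-tabulate)
open import Data.List.Relation.Binary.Permutation.Propositional using (_↭_; refl; prep; swap; trans; ↭-sym; ↭-trans)
open import Data.List.Relation.Binary.Permutation.Propositional.Properties using (shift; ↭-length; ∈-resp-↭) renaming (map⁺ to ↭-map⁺)
open import Data.List.Relation.Unary.All as All using (All; []; _∷_)
open import Data.List.Relation.Unary.All.Properties using (¬Any⇒All¬)
open import Data.List.Relation.Unary.Any using (here; there; any?)
open import Data.List.Relation.Unary.AllPairs using ([]; _∷_)
open import Data.List.Relation.Unary.Unique.Propositional using (Unique)
import Data.List.Relation.Unary.Unique.Propositional.Properties as Unique
open import Data.Nat using (zero; suc; _+_; _<_; z≤n; s≤s; _%_; _<?_)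
open import Data.Nat.DivMod using (m≡m%n+[m/n]*n; m%n<n; +-distrib-/-∣ʳ; m*n/n≡m)
open import Data.Nat.Divisibility using (divides-refl)
open import Data.Nat.Induction using (<-wellFounded)
open import Data.Nat.ListAction using () renaming (sum to listSum)
open import Data.Nat.ListAction.Properties using (sum-++; sum-↭)
open import Data.Nat.Properties
open import Data.Nat.Solver using (module +-*-Solver)
open import Data.Product using (_,_; proj₂; ∃-syntax; ∃₂)
import Data.Sum as ⊎
open import Data.Sum using (inj₁; inj₂; [_,_]′)
import Data.Vec as Vec
open import Data.Vec using ([]; _∷_)
open import Data.Vec.Properties using (≡-dec)
open import Function using (_∘_; id)
open import Function.Bundles using (mk⇔; Equivalence)
open import Induction.WellFounded using (Acc; acc)
open import Relation.Binary using (tri<; tri≈; tri>; DecidableEquality)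
open import Relation.Binary.PropositionalEquality as ≡ using (refl; sym; cong; cong₂; subst)
open import Relation.Nullary using (¬_; ¬?; Dec; yes; no; does; contradiction; decidable-stable)
open import Level using (0ℓ)
open import Relation.Unary using (Pred; Decidable)

open +-*-Solver using (solve; _:+_; _:*_; _:=_; con)

private
  variable
    A : Set
    n t : ℕ

-- Duplicate-free lists

-- Induction on `xs`: one occurrence of the head is cut out of `ys`, and the tail, which avoids the
-- head, still lies in what remains.
unique-⊆⇒length≤ : {xs ys : List A} → Unique xs → (∀ {x} → x ∈ xs → x ∈ ys) → length xs ≤ length ys
unique-⊆⇒length≤ [] _ = z≤n
unique-⊆⇒length≤ {xs = x ∷ xs} {ys} (x∉xs ∷ uniq) sub with ∈-∃++ (sub (here refl))
... | as , bs , refl = subst (suc (length xs) ≤_) (sym (↭-length σ)) (s≤s (unique-⊆⇒length≤ uniq sub′))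
  where
  σ : as ++ x ∷ bs ↭ x ∷ as ++ bs
  σ = shift x as bs
  sub′ : ∀ {y} → y ∈ xs → y ∈ as ++ bs
  sub′ y∈xs with ∈-resp-↭ σ (sub (there y∈xs))
  ... | here refl = contradiction refl (All.lookup x∉xs y∈xs)
  ... | there y∈  = y∈

-- The pigeonhole step behind distinct representatives: a set with more elements than have already
-- been chosen offers a new one.
∃∈-∉ : DecidableEquality A → {xs : List A} (ys : List A) → Unique xs →
  length ys < length xs → ∃[ x ] x ∈ xs × x ∉ ys
∃∈-∉ _≟_ {xs} ys uniq lt with any? (λ x → ¬? (x ∈? ys)) xs
  where open DecMembership _≟_ using (_∈?_)
... | yes p = find p
... | no ¬p = contradiction (unique-⊆⇒length≤ uniq λ x∈ →
      decidable-stable (_ ∈? ys) (All.lookup (¬Any⇒All¬ xs ¬p) x∈)) (<⇒≱ lt)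
  where open DecMembership _≟_ using (_∈?_)

indicator : {P : Pred A 0ℓ} → Decidable P → A → ℕ
indicator P? x = if does (P? x) then 1 else 0

length-filter≡sum : {P : Pred A 0ℓ} (P? : Decidable P) (xs : List A) →
  length (filter P? xs) ≡ listSum (map (indicator P?) xs)
length-filter≡sum P? [] = refl
length-filter≡sum P? (x ∷ xs) with does (P? x)
... | true  = cong suc (length-filter≡sum P? xs)
... | false = length-filter≡sum P? xs

-- Sums over the pairs of a list

sum-map-≤ : (f : A → ℕ) (c : ℕ) (xs : List A) → All (λ x → f x ≤ c) xs → listSum (map f xs) ≤ length xs * c
sum-map-≤ f c [] [] = z≤n
sum-map-≤ f c (x ∷ xs) (p ∷ ps) = +-mono-≤ p (sum-map-≤ f c xs ps)

sum-map-+ : (f g : A → ℕ) (xs : List A) →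
  listSum (map (λ x → f x + g x) xs) ≡ listSum (map f xs) + listSum (map g xs)
sum-map-+ f g [] = refl
sum-map-+ f g (x ∷ xs) rewrite sum-map-+ f g xs =
  solve 4 (λ a b c d → (a :+ b) :+ (c :+ d) := (a :+ c) :+ (b :+ d)) refl
    (f x) (g x) (listSum (map f xs)) (listSum (map g xs))

sum-map-const : (c : ℕ) (xs : List A) → listSum (map (λ _ → c) xs) ≡ length xs * c
sum-map-const c [] = refl
sum-map-const c (x ∷ xs) = cong (c +_) (sum-map-const c xs)

pairSum : (A → A → ℕ) → List A → ℕ
pairSum w []       = 0
pairSum w (x ∷ xs) = listSum (map (w x) xs) + pairSum w xs

pairSum-↭ : {w : A → A → ℕ} → (∀ x y → w x y ≡ w y x) → {xs ys : List A} → xs ↭ ys → pairSum w xs ≡ pairSum w ys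
pairSum-↭ w-sym refl = refl
pairSum-↭ {w = w} w-sym (prep x σ) = cong₂ _+_ (sum-↭ (↭-map⁺ (w x) σ)) (pairSum-↭ w-sym σ)
pairSum-↭ {w = w} w-sym (swap {xs} {ys} x y σ)
  rewrite w-sym x y | sum-↭ (↭-map⁺ (w x) σ) | sum-↭ (↭-map⁺ (w y) σ) | pairSum-↭ w-sym σ =
  solve 4 (λ a b c d → (a :+ b) :+ (c :+ d) := (a :+ c) :+ (b :+ d)) refl
    (w y x) (listSum (map (w x) ys)) (listSum (map (w y) ys)) (pairSum w ys)
pairSum-↭ w-sym (trans σ τ) = ≡.trans (pairSum-↭ w-sym σ) (pairSum-↭ w-sym τ)

-- The bound is pairSum w xs ≤ c * m (m - 1) / 2 for m = length xs, freed of
-- subtraction and division.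
pairSum-≤⊎∃> : (w : A → A → ℕ) (c : ℕ) (xs : List A) →
  2 * pairSum w xs + c * length xs ≤ c * (length xs * length xs) ⊎
  (∃[ u ] ∃[ v ] ∃[ ys ] xs ↭ u ∷ v ∷ ys × c < w u v)
pairSum-≤⊎∃> w c [] rewrite *-zeroʳ c = inj₁ z≤n
pairSum-≤⊎∃> w c (x ∷ xs) with any? (λ y → c <? w x y) xs
... | yes p with find p
...   | y , y∈xs , c<wxy with ∈-∃++ y∈xs
...     | as , bs , refl = inj₂ (x , y , as ++ bs , prep x (shift y as bs) , c<wxy)
pairSum-≤⊎∃> w c (x ∷ xs) | no ¬p with pairSum-≤⊎∃> w c xs
... | inj₂ (u , v , ys , σ , c<wuv) =
  inj₂ (u , v , x ∷ ys , ↭-trans (prep x σ) (↭-sym (shift x (u ∷ v ∷ []) ys)) , c<wuv)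
... | inj₁ bound = inj₁ (begin
  2 * (s + p) + c * suc m
    ≡⟨ solve 4 (λ s p c m → con 2 :* (s :+ p) :+ c :* (con 1 :+ m)
         := (con 2 :* s :+ c) :+ (con 2 :* p :+ c :* m)) refl s p c m ⟩
  (2 * s + c) + (2 * p + c * m)
    ≤⟨ +-mono-≤ (+-monoˡ-≤ c (*-monoʳ-≤ 2 (sum-map-≤ (w x) c xs (All.map ≮⇒≥ (¬Any⇒All¬ xs ¬p))))) bound ⟩
  (2 * (m * c) + c) + c * (m * m)
    ≡⟨ solve 2 (λ c m → (con 2 :* (m :* c) :+ c) :+ c :* (m :* m)
         := c :* ((con 1 :+ m) :* (con 1 :+ m))) refl c m ⟩
  c * (suc m * suc m) ∎)
  where
  open ≤-Reasoning
  m = length xs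
  s = listSum (map (w x) xs)
  p = pairSum w xs

-- With `f = w x` the first sum runs over all triples through an apex `x`. Each `f y` occurs in
-- `length xs ∸ 1` pairs; the extra sum on the left replaces that subtraction.
pairSum-star : (f : A → ℕ) (w : A → A → ℕ) (xs : List A) →
  pairSum (λ y z → f y + f z + w y z) xs + listSum (map f xs) ≡ length xs * listSum (map f xs) + pairSum w xs
pairSum-star f w [] = refl
pairSum-star f w (x ∷ xs) = begin
  listSum (map (λ z → f x + f z + w x z) xs) + q + (f x + s)
    ≡⟨ cong (λ a → a + q + (f x + s)) (≡.trans (sum-map-+ (λ z → f x + f z) (w x) xs)
         (cong (_+ r) (≡.trans (sum-map-+ (λ _ → f x) f xs) (cong (_+ s) (sum-map-const (f x) xs))))) ⟩
  m * f x + s + r + q + (f x + s)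
    ≡⟨ solve 5 (λ m a s r q → m :* a :+ s :+ r :+ q :+ (a :+ s)
         := m :* a :+ s :+ r :+ a :+ (q :+ s)) refl m (f x) s r q ⟩
  m * f x + s + r + f x + (q + s)
    ≡⟨ cong (m * f x + s + r + f x +_) (pairSum-star f w xs) ⟩
  m * f x + s + r + f x + (m * s + p)
    ≡⟨ solve 5 (λ m a s r p → m :* a :+ s :+ r :+ a :+ (m :* s :+ p)
         := (con 1 :+ m) :* (a :+ s) :+ (r :+ p)) refl m (f x) s r p ⟩
  suc m * (f x + s) + (r + p) ∎
  where
  open ≡.≡-Reasoning
  m = length xs
  q = pairSum (λ y z → f y + f z + w y z) xs
  p = pairSum w xs
  r = listSum (map (w x) xs)
  s = listSum (map f xs)

-- Among `2 + m` points every pair lies in `m` triples, and six times the number of triples is the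
-- right-hand side. The double counting is done by induction, removing one point at a time.
pairSum-triangle≤6 : (w : A → A → ℕ) → (∀ x y z → w x y + w x z + w y z ≤ 6) →
  (m : ℕ) (xs : List A) → length xs ≡ 2 + m → m * pairSum w xs ≤ (2 + m) * (1 + m) * m
pairSum-triangle≤6 w tri zero xs _ = z≤n
-- Triples through `x` are treated as pairs of `xs` weighted by the whole triangle, so the dichotomy
-- for pairs applies with bound 6.
pairSum-triangle≤6 w tri (suc m) (x ∷ xs) eq with pairSum-≤⊎∃> (λ y z → w x y + w x z + w y z) 6 xs
... | inj₂ (u , v , _ , _ , 6<) = contradiction (tri x u v) (<⇒≱ 6<)
... | inj₁ bound = begin
  suc m * (s + p)
    -- The first summand is the total over triples through `x`: each pair at `x` lies in `1 + m` of
    -- them, each pair of `xs` in one. The second counts the triples inside `xs`.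
    ≡⟨ solve 3 (λ m s p → (con 1 :+ m) :* (s :+ p) := ((con 1 :+ m) :* s :+ p) :+ m :* p) refl m s p ⟩
  (suc m * s + p) + m * p
    ≤⟨ +-mono-≤ star≤ (pairSum-triangle≤6 w tri m xs len) ⟩
  3 * ((2 + m) * (1 + m)) + (2 + m) * (1 + m) * m
    ≡⟨ solve 1 (λ m → con 3 :* ((con 2 :+ m) :* (con 1 :+ m)) :+ (con 2 :+ m) :* (con 1 :+ m) :* m
         := (con 3 :+ m) :* (con 2 :+ m) :* (con 1 :+ m)) refl m ⟩
  (3 + m) * (2 + m) * (1 + m) ∎
  where
  open ≤-Reasoning
  len = suc-injective eq
  p = pairSum w xs
  q = pairSum (λ y z → w x y + w x z + w y z) xs
  s = listSum (map (w x) xs)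
  q≡ : q ≡ suc m * s + p
  q≡ = +-cancelʳ-≡ s q (suc m * s + p) (≡.trans (pairSum-star (w x) w xs)
    (≡.trans (cong (λ k → k * s + p) len)
      (solve 3 (λ m s p → (con 2 :+ m) :* s :+ p := (con 1 :+ m) :* s :+ p :+ s) refl m s p)))
  star≤ : suc m * s + p ≤ 3 * ((2 + m) * (1 + m))
  star≤ = subst (_≤ 3 * ((2 + m) * (1 + m))) q≡ (*-cancelˡ-≤ 2 (+-cancelʳ-≤ (6 * (2 + m)) (2 * q) _ (begin
    2 * q + 6 * (2 + m)           ≡⟨ cong (λ k → 2 * q + 6 * k) len ⟨
    2 * q + 6 * length xs         ≤⟨ bound ⟩
    6 * (length xs * length xs)   ≡⟨ cong (λ k → 6 * (k * k)) len ⟩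
    6 * ((2 + m) * (2 + m))
      ≡⟨ solve 1 (λ m → con 6 :* ((con 2 :+ m) :* (con 2 :+ m))
           := con 2 :* (con 3 :* ((con 2 :+ m) :* (con 1 :+ m))) :+ con 6 :* (con 2 :+ m)) refl m ⟩
    2 * (3 * ((2 + m) * (1 + m))) + 6 * (2 + m) ∎)))

-- Arithmetic of ⌊n²/4⌋ and the weighted Mantel bound

n^2≡n*n : ∀ n → n ^ 2 ≡ n * n
n^2≡n*n n = cong (n *_) (*-identityʳ n)

-- A remainder modulo 4 is at most 3, so only `n` below 3 calls for computation.
n*n%4≤n : ∀ n → n * n % 4 ≤ n
n*n%4≤n 0 = z≤n
n*n%4≤n 1 = s≤s z≤n
n*n%4≤n 2 = z≤n
n*n%4≤n n@(suc (suc (suc k))) = ≤-trans (≤-pred (m%n<n (n * n) 4)) (s≤s (s≤s (s≤s z≤n)))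

-- The hypothesis is p ≤ n(n - 1). As n² exceeds 4⌊n²/4⌋ by a remainder of at most n, subtracting n
-- from n² leaves at most 4⌊n²/4⌋.
+n≤n*n⇒≤4*quarter : ∀ p n → p + n ≤ n * n → p ≤ 4 * (n ^ 2 / 4)
+n≤n*n⇒≤4*quarter p n p+n≤ = +-cancelʳ-≤ n p _ (begin
  p + n                         ≤⟨ p+n≤ ⟩
  n * n                         ≡⟨ m≡m%n+[m/n]*n (n * n) 4 ⟩
  n * n % 4 + n * n / 4 * 4     ≤⟨ +-monoˡ-≤ _ (n*n%4≤n n) ⟩
  n + n * n / 4 * 4             ≡⟨ +-comm n _ ⟩
  n * n / 4 * 4 + n             ≡⟨ cong (_+ n) (*-comm (n * n / 4) 4) ⟩
  4 * (n * n / 4) + n           ≡⟨ cong (λ k → 4 * (k / 4) + n) (n^2≡n*n n) ⟨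
  4 * (n ^ 2 / 4) + n           ∎)
  where open ≤-Reasoning

-- From (n + 2)² = n² + 4(n + 1); this is the room gained by two further vertices.
quarter-2+ : ∀ n → (2 + n) ^ 2 / 4 ≡ n ^ 2 / 4 + suc n
quarter-2+ n = begin
  (2 + n) ^ 2 / 4              ≡⟨ cong (_/ 4) (≡.trans (n^2≡n*n (2 + n)) (≡.trans
                                    (solve 1 (λ n → (con 2 :+ n) :* (con 2 :+ n)
                                      := n :* n :+ (con 1 :+ n) :* con 4) refl n)
                                    (cong (_+ suc n * 4) (sym (n^2≡n*n n))))) ⟩
  (n ^ 2 + suc n * 4) / 4      ≡⟨ +-distrib-/-∣ʳ (n ^ 2) (divides-refl (suc n)) ⟩
  n ^ 2 / 4 + suc n * 4 / 4    ≡⟨ cong (n ^ 2 / 4 +_) (m*n/n≡m (suc n) 4) ⟩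
  n ^ 2 / 4 + suc n            ∎
  where open ≡.≡-Reasoning

-- The recursion is well-founded on the length, because the heavy pair may sit anywhere: the
-- remaining list `ys` is reached through a permutation and is not a structural tail of `xs`.
pairSum-mantel : 4 ≤ t → (w : A → A → ℕ) → (∀ x y → w x y ≡ w y x) → (∀ x y → w x y ≤ t) →
  (∀ u v x → 2 < w u v → w u x + w v x ≤ t) →
  (xs : List A) → pairSum w xs ≤ t * (length xs ^ 2 / 4)
pairSum-mantel {t = t} 4≤t w w-sym w≤t heavy xs = go xs (<-wellFounded (length xs))
  where
  open ≤-Reasoning
  go : ∀ xs → Acc _<_ (length xs) → pairSum w xs ≤ t * (length xs ^ 2 / 4)
  go xs (acc rec) with pairSum-≤⊎∃> w 2 xs
  -- All weights at most 2 give a total of at most n(n - 1), hence at most 4⌊n²/4⌋; here `4 ≤ t`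
  -- enters.
  ... | inj₁ light = ≤-trans
    (+n≤n*n⇒≤4*quarter (pairSum w xs) (length xs)
      (*-cancelˡ-≤ 2 (subst (_≤ 2 * (length xs * length xs)) (sym (*-distribˡ-+ 2 (pairSum w xs) (length xs))) light)))
    (*-monoˡ-≤ (length xs ^ 2 / 4) 4≤t)
  ... | inj₂ (u , v , ys , σ , 2<wuv) = begin
    pairSum w xs                       ≡⟨ pairSum-↭ w-sym σ ⟩
    w u v + a + (b + p)
      ≡⟨ solve 4 (λ c a b p → c :+ a :+ (b :+ p) := c :+ (a :+ b) :+ p) refl (w u v) a b p ⟩
    w u v + (a + b) + p
      ≡⟨ cong (λ s → w u v + s + p) (sum-map-+ (w u) (w v) ys) ⟨
    w u v + listSum (map (λ x → w u x + w v x) ys) + p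
      -- The heavy pair itself costs at most `t`, and so do the two pairs joining it to each of the
      -- `m` other vertices.
      ≤⟨ +-mono-≤ (+-mono-≤ (w≤t u v) (sum-map-≤ _ t ys (All.universal (λ x → heavy u v x 2<wuv) ys)))
           (go ys (rec (subst (length ys <_) (sym (↭-length σ)) (s≤s (n≤1+n _))))) ⟩
    t + m * t + t * (m ^ 2 / 4)
      ≡⟨ solve 3 (λ t m k → t :+ m :* t :+ t :* k := t :* (k :+ (con 1 :+ m))) refl t m (m ^ 2 / 4) ⟩
    t * (m ^ 2 / 4 + suc m)            ≡⟨ cong (t *_) (quarter-2+ m) ⟨
    t * ((2 + m) ^ 2 / 4)              ≡⟨ cong (λ k → t * (k ^ 2 / 4)) (↭-length σ) ⟨
    t * (length xs ^ 2 / 4)            ∎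
    where
    m = length ys
    a = listSum (map (w u) ys)
    b = listSum (map (w v) ys)
    p = pairSum w ys

-- Exchanging sums over indices with sums over pairs

sum-mono-≤ : {f g : Fin n → ℕ} → (∀ i → f i ≤ g i) → sum f ≤ sum g
sum-mono-≤ {n = zero}  f≤g = z≤n
sum-mono-≤ {n = suc n} f≤g = +-mono-≤ (f≤g Fin.zero) (sum-mono-≤ (f≤g ∘ Fin.suc))

sum≡listSum : (f : Fin n → ℕ) → sum f ≡ listSum (tabulate f)
sum≡listSum {n = zero}  f = refl
sum≡listSum {n = suc n} f = cong (f Fin.zero +_) (sum≡listSum (f ∘ Fin.suc))

sum-listSum-comm : (f : Fin t → A → ℕ) (xs : List A) →
  sum (λ i → listSum (map (f i) xs)) ≡ listSum (map (λ x → sum (λ i → f i x)) xs)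
sum-listSum-comm {t = t} f [] = sum-replicate-zero +-0-commutativeMonoid t
sum-listSum-comm f (x ∷ xs) = ≡.trans
  (∑-distrib-+ +-0-commutativeMonoid (λ i → f i x) (λ i → listSum (map (f i) xs)))
  (cong (sum (λ i → f i x) +_) (sum-listSum-comm f xs))

sum-pairSum-comm : (w : Fin t → A → A → ℕ) (xs : List A) →
  sum (λ i → pairSum (w i) xs) ≡ pairSum (λ x y → sum (λ i → w i x y)) xs
sum-pairSum-comm {t = t} w [] = sum-replicate-zero +-0-commutativeMonoid t
sum-pairSum-comm w (x ∷ xs) = ≡.trans
  (∑-distrib-+ +-0-commutativeMonoid (λ i → listSum (map (w i x) xs)) (λ i → pairSum (w i) xs))
  (cong₂ _+_ (sum-listSum-comm (λ i → w i x) xs) (sum-pairSum-comm w xs))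

pairSum-cong : {w w′ : A → A → ℕ} → (∀ x y → w x y ≡ w′ x y) → (xs : List A) → pairSum w xs ≡ pairSum w′ xs
pairSum-cong eq [] = refl
pairSum-cong eq (x ∷ xs) = cong₂ _+_ (cong listSum (map-cong (eq x) xs)) (pairSum-cong eq xs)

-- Two-element and three-element subsets

edge : Fin n → Fin n → Subset n
edge x y = ⁅ x ⁆ ∪ ⁅ y ⁆

edge-comm : (x y : Fin n) → edge x y ≡ edge y x
edge-comm x y = ∪-comm ⁅ x ⁆ ⁅ y ⁆

∣edge∣≡2⇒≢ : (x y : Fin n) → ∣ edge x y ∣ ≡ 2 → x ≢ y
∣edge∣≡2⇒≢ x _ two refl with ≡.trans (sym two) (≡.trans (cong ∣_∣ (∪-idem ⁅ x ⁆)) (∣⁅x⁆∣≡1 x))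
... | ()

∣p∣≡0⇒p≡∅ : (p : Subset n) → ∣ p ∣ ≡ 0 → p ≡ ∅
∣p∣≡0⇒p≡∅ []            _  = refl
∣p∣≡0⇒p≡∅ (outside ∷ p) eq = cong (outside ∷_) (∣p∣≡0⇒p≡∅ p eq)

∣p∣≡1⇒p≡⁅x⁆ : (p : Subset n) → ∣ p ∣ ≡ 1 → ∃[ x ] p ≡ ⁅ x ⁆
∣p∣≡1⇒p≡⁅x⁆ (inside ∷ p)  eq = Fin.zero , cong (inside ∷_) (∣p∣≡0⇒p≡∅ p (suc-injective eq))
∣p∣≡1⇒p≡⁅x⁆ (outside ∷ p) eq with ∣p∣≡1⇒p≡⁅x⁆ p eq
... | x , refl = Fin.suc x , refl

∣p∣≡2⇒p≡edge : (p : Subset n) → ∣ p ∣ ≡ 2 → ∃₂ λ x y → p ≡ edge x y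
∣p∣≡2⇒p≡edge (inside ∷ p) eq with ∣p∣≡1⇒p≡⁅x⁆ p (suc-injective eq)
... | x , refl = Fin.zero , Fin.suc x , cong (inside ∷_) (sym (∪-identityˡ ⁅ x ⁆))
∣p∣≡2⇒p≡edge (outside ∷ p) eq with ∣p∣≡2⇒p≡edge p eq
... | x , y , refl = Fin.suc x , Fin.suc y , refl

∣⁅x⁆∪p∣≡1+∣p∣ : (x : Fin n) (p : Subset n) → x ∉ˢ p → ∣ ⁅ x ⁆ ∪ p ∣ ≡ suc ∣ p ∣
∣⁅x⁆∪p∣≡1+∣p∣ Fin.zero    (inside ∷ p)  x∉p = contradiction Vec.here x∉p
∣⁅x⁆∪p∣≡1+∣p∣ Fin.zero    (outside ∷ p) x∉p = cong (suc ∘ ∣_∣) (∪-identityˡ p)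
∣⁅x⁆∪p∣≡1+∣p∣ (Fin.suc x) (inside ∷ p)  x∉p = cong suc (∣⁅x⁆∪p∣≡1+∣p∣ x p (x∉p ∘ Vec.there))
∣⁅x⁆∪p∣≡1+∣p∣ (Fin.suc x) (outside ∷ p) x∉p = ∣⁅x⁆∪p∣≡1+∣p∣ x p (x∉p ∘ Vec.there)

x∈edge⁻ : {x y z : Fin n} → x ∈ˢ edge y z → x ≡ y ⊎ x ≡ z
x∈edge⁻ {y = y} {z} x∈ with x∈p∪q⁻ ⁅ y ⁆ ⁅ z ⁆ x∈
... | inj₁ x∈y = inj₁ (x∈⁅y⁆⇒x≡y y x∈y)
... | inj₂ x∈z = inj₂ (x∈⁅y⁆⇒x≡y z x∈z)

edge-⊆ : {x y : Fin n} {T : Subset n} → x ∈ˢ T → y ∈ˢ T → edge x y ⊆ T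
edge-⊆ x∈T y∈T z∈ with x∈edge⁻ z∈
... | inj₁ refl = x∈T
... | inj₂ refl = y∈T

x∈edge : (x y : Fin n) → x ∈ˢ edge x y
x∈edge x y = x∈p∪q⁺ (inj₁ (x∈⁅x⁆ x))

y∈edge : (x y : Fin n) → y ∈ˢ edge x y
y∈edge x y = x∈p∪q⁺ {p = ⁅ x ⁆} (inj₂ (x∈⁅x⁆ y))

-- The cardinalities carry the distinctness of the vertices, since `edge x x` is a singleton. The
-- three-element set is {x, y, z}.
edges-isTriangle : (x y z : Fin n) →
  ∣ edge x y ∣ ≡ 2 → ∣ edge x z ∣ ≡ 2 → ∣ edge y z ∣ ≡ 2 →
  IsTriangle (edge x y) (edge x z) (edge y z)
edges-isTriangle x y z ∣xy∣ ∣xz∣ ∣yz∣ =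
  T , ≡.trans (∣⁅x⁆∪p∣≡1+∣p∣ x (edge y z) ([ ∣edge∣≡2⇒≢ x y ∣xy∣ , ∣edge∣≡2⇒≢ x z ∣xz∣ ]′ ∘ x∈edge⁻)) (cong suc ∣yz∣) ,
  λ E → mk⇔ to (λ (∣E∣ , E⊆T) → from E ∣E∣ E⊆T)
  where
  T = ⁅ x ⁆ ∪ edge y z
  x∈T : x ∈ˢ T
  x∈T = x∈p∪q⁺ (inj₁ (x∈⁅x⁆ x))
  y∈T : y ∈ˢ T
  y∈T = x∈p∪q⁺ {p = ⁅ x ⁆} (inj₂ (x∈edge y z))
  z∈T : z ∈ˢ T
  z∈T = x∈p∪q⁺ {p = ⁅ x ⁆} (inj₂ (y∈edge y z))
  vertex : ∀ {a} → a ∈ˢ T → a ≡ x ⊎ a ≡ y ⊎ a ≡ z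
  vertex a∈T with x∈p∪q⁻ ⁅ x ⁆ (edge y z) a∈T
  ... | inj₁ a∈x  = inj₁ (x∈⁅y⁆⇒x≡y x a∈x)
  ... | inj₂ a∈yz = inj₂ (x∈edge⁻ a∈yz)
  to : ∀ {E} → E ≡ edge x y ⊎ E ≡ edge x z ⊎ E ≡ edge y z → ∣ E ∣ ≡ 2 × E ⊆ T
  to (inj₁ refl)        = ∣xy∣ , edge-⊆ x∈T y∈T
  to (inj₂ (inj₁ refl)) = ∣xz∣ , edge-⊆ x∈T z∈T
  to (inj₂ (inj₂ refl)) = ∣yz∣ , edge-⊆ y∈T z∈T
  from : ∀ E → ∣ E ∣ ≡ 2 → E ⊆ T → E ≡ edge x y ⊎ E ≡ edge x z ⊎ E ≡ edge y z
  from E ∣E∣ E⊆T with ∣p∣≡2⇒p≡edge E ∣E∣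
  -- Both endpoints of `E` are among x, y, z: equal endpoints contradict `∣ E ∣ ≡ 2`, and the six
  -- remaining cases are the three edges in both orientations.
  ... | a , b , refl with vertex (E⊆T (x∈edge a b)) | vertex (E⊆T (y∈edge a b))
  ... | inj₁ refl        | inj₁ refl        = contradiction refl (∣edge∣≡2⇒≢ a b ∣E∣)
  ... | inj₁ refl        | inj₂ (inj₁ refl) = inj₁ refl
  ... | inj₁ refl        | inj₂ (inj₂ refl) = inj₂ (inj₁ refl)
  ... | inj₂ (inj₁ refl) | inj₁ refl        = inj₁ (edge-comm a b)
  ... | inj₂ (inj₁ refl) | inj₂ (inj₁ refl) = contradiction refl (∣edge∣≡2⇒≢ a b ∣E∣)
  ... | inj₂ (inj₁ refl) | inj₂ (inj₂ refl) = inj₂ (inj₂ refl)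
  ... | inj₂ (inj₂ refl) | inj₁ refl        = inj₂ (inj₁ (edge-comm a b))
  ... | inj₂ (inj₂ refl) | inj₂ (inj₁ refl) = inj₂ (inj₂ (edge-comm a b))
  ... | inj₂ (inj₂ refl) | inj₂ (inj₂ refl) = contradiction refl (∣edge∣≡2⇒≢ a b ∣E∣)

-- Rainbow triangles with indices in any order

isTriangle-swap₁₂ : {E₁ E₂ E₃ : Subset n} → IsTriangle E₁ E₂ E₃ → IsTriangle E₂ E₁ E₃
isTriangle-swap₁₂ (T , ∣T∣ , iff) = T , ∣T∣ , λ E →
  mk⇔ (Equivalence.to (iff E) ∘ swap₁₂) (swap₁₂ ∘ Equivalence.from (iff E))
  where
  swap₁₂ : ∀ {P Q R : Set} → P ⊎ Q ⊎ R → Q ⊎ P ⊎ R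
  swap₁₂ = [ inj₂ ∘ inj₁ , [ inj₁ , inj₂ ∘ inj₂ ]′ ]′

isTriangle-swap₂₃ : {E₁ E₂ E₃ : Subset n} → IsTriangle E₁ E₂ E₃ → IsTriangle E₁ E₃ E₂
isTriangle-swap₂₃ (T , ∣T∣ , iff) = T , ∣T∣ , λ E →
  mk⇔ (Equivalence.to (iff E) ∘ ⊎.map₂ ⊎.swap) (⊎.map₂ ⊎.swap ∘ Equivalence.from (iff E))

-- Rainbow-freeness speaks of increasing indices only. With `j` and `k` in order, `i` falls before,
-- between or after them, and the edges are permuted accordingly.
¬triangle-sorted₂₃ : (𝒢 : Fin t → Graph n) → RainbowTriangleFree 𝒢 →
  ∀ {i j k E₁ E₂ E₃} → i ≢ j → i ≢ k → j Fin.< k →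
  E₁ ∈ᴳ 𝒢 i → E₂ ∈ᴳ 𝒢 j → E₃ ∈ᴳ 𝒢 k → ¬ IsTriangle E₁ E₂ E₃
¬triangle-sorted₂₃ 𝒢 free {i} {j} {k} i≢j i≢k j<k e₁ e₂ e₃ triangle with Fin.<-cmp i j | Fin.<-cmp i k
... | tri≈ _ i≡j _ | _            = i≢j i≡j
... | _            | tri≈ _ i≡k _ = i≢k i≡k
... | tri< i<j _ _ | _            =
  free (_ , _ , _ , i<j , j<k , _ , _ , _ , e₁ , e₂ , e₃ , triangle)
... | tri> _ _ j<i | tri< i<k _ _ =
  free (_ , _ , _ , j<i , i<k , _ , _ , _ , e₂ , e₁ , e₃ , isTriangle-swap₁₂ triangle)
... | tri> _ _ _   | tri> _ _ k<i =
  free (_ , _ , _ , j<k , k<i , _ , _ , _ , e₂ , e₃ , e₁ , isTriangle-swap₂₃ (isTriangle-swap₁₂ triangle))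

-- One more transposition puts the last two indices in order, which covers all six arrangements.
¬triangle-distinct : (𝒢 : Fin t → Graph n) → RainbowTriangleFree 𝒢 →
  ∀ {i j k E₁ E₂ E₃} → i ≢ j → i ≢ k → j ≢ k →
  E₁ ∈ᴳ 𝒢 i → E₂ ∈ᴳ 𝒢 j → E₃ ∈ᴳ 𝒢 k → ¬ IsTriangle E₁ E₂ E₃
¬triangle-distinct 𝒢 free {i} {j} {k} i≢j i≢k j≢k e₁ e₂ e₃ triangle with Fin.<-cmp j k
... | tri≈ _ j≡k _ = j≢k j≡k
... | tri< j<k _ _ = ¬triangle-sorted₂₃ 𝒢 free i≢j i≢k j<k e₁ e₂ e₃ triangle
... | tri> _ _ k<j = ¬triangle-sorted₂₃ 𝒢 free i≢k i≢j k<j e₁ e₃ e₂ (isTriangle-swap₂₃ triangle)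

-- Colours of a pair of vertices

_∈ᴳ?_ : (E : Subset n) (G : Graph n) → Dec (E ∈ᴳ G)
E ∈ᴳ? G = E ∈? edges G
  where open DecMembership (≡-dec Bool._≟_) using (_∈?_)

-- edge x x is a singleton, so colours 𝒢 x x is empty: the vertices in the
-- lemmas below need not be assumed distinct.
colours : (Fin t → Graph n) → Fin n → Fin n → List (Fin t)
colours {t} 𝒢 x y = filter (λ i → edge x y ∈ᴳ? 𝒢 i) (allFin t)

weight : (Fin t → Graph n) → Fin n → Fin n → ℕ
weight 𝒢 x y = length (colours 𝒢 x y)

colours-comm : (𝒢 : Fin t → Graph n) → ∀ x y → colours 𝒢 x y ≡ colours 𝒢 y x
colours-comm {t} 𝒢 x y = cong (λ E → filter (λ i → E ∈ᴳ? 𝒢 i) (allFin t)) (edge-comm x y)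

colours-unique : (𝒢 : Fin t → Graph n) → ∀ x y → Unique (colours 𝒢 x y)
colours-unique {t} 𝒢 x y = Unique.filter⁺ (λ i → edge x y ∈ᴳ? 𝒢 i) (Unique.allFin⁺ t)

weight≤ : (𝒢 : Fin t → Graph n) → ∀ x y → weight 𝒢 x y ≤ t
weight≤ {t} 𝒢 x y = subst (weight 𝒢 x y ≤_) (length-tabulate id)
  (length-filter (λ i → edge x y ∈ᴳ? 𝒢 i) (allFin t))

∃colour∉ : (𝒢 : Fin t → Graph n) → ∀ x y (is : List (Fin t)) → length is < weight 𝒢 x y →
  ∃[ i ] edge x y ∈ᴳ 𝒢 i × i ∉ is
∃colour∉ {t} 𝒢 x y is lt with ∃∈-∉ Fin._≟_ is (colours-unique 𝒢 x y) lt
... | i , i∈ , i∉is = i , proj₂ (∈-filter⁻ (λ i → edge x y ∈ᴳ? 𝒢 i) {xs = allFin t} i∈) , i∉is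

-- If the sum exceeded `t`, neither weight would be 0, both being at most `t`, and one would be at
-- least 2. Then ux and vx have different colours `j` and `k`, and uv has a third one, giving a
-- rainbow triangle.
weight-heavy : (𝒢 : Fin t → Graph n) → t ≥ 3 → RainbowTriangleFree 𝒢 →
  ∀ u v x → 2 < weight 𝒢 u v → weight 𝒢 u x + weight 𝒢 v x ≤ t
weight-heavy {t} 𝒢 t≥3 free u v x 2<uv = ≮⇒≥ absurd
  where
  ∣_∣≡2 : ∀ {E i} → E ∈ᴳ 𝒢 i → ∣ E ∣ ≡ 2
  ∣_∣≡2 {i = i} E∈ = All.lookup (pairs (𝒢 i)) E∈

  ¬distinct : ∀ {j k} → edge u x ∈ᴳ 𝒢 j → edge v x ∈ᴳ 𝒢 k → j ≢ k → ⊥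
  -- A pair with three colours keeps one outside `j` and `k`.
  ¬distinct {j} {k} ux∈ vx∈ j≢k with ∃colour∉ 𝒢 u v (j ∷ k ∷ []) 2<uv
  ... | i , uv∈ , i∉ = ¬triangle-distinct 𝒢 free
    (i∉ ∘ here) (i∉ ∘ there ∘ here) j≢k uv∈ ux∈ vx∈
    (edges-isTriangle u v x ∣ uv∈ ∣≡2 ∣ ux∈ ∣≡2 ∣ vx∈ ∣≡2)

  absurd : t < weight 𝒢 u x + weight 𝒢 v x → ⊥
  absurd t< with 1 <? weight 𝒢 u x
  -- The pair with two colours is served last: first any colour `k` of vx, then a colour of ux other
  -- than `k`.
  ... | yes 1<ux with ∃colour∉ 𝒢 v x [] (+-cancelˡ-< t 0 _ (begin-strict
      t + 0                           ≡⟨ +-identityʳ t ⟩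
      t                               <⟨ t< ⟩
      weight 𝒢 u x + weight 𝒢 v x     ≤⟨ +-monoˡ-≤ _ (weight≤ 𝒢 u x) ⟩
      t + weight 𝒢 v x                ∎))
    where open ≤-Reasoning
  ...   | k , vx∈ , _ with ∃colour∉ 𝒢 u x (k ∷ []) 1<ux
  ...     | j , ux∈ , j∉ = ¬distinct ux∈ vx∈ (j∉ ∘ here)
  -- Now ux has at most one colour, so vx has at least `t ≥ 3` of them, and the order of choice is
  -- reversed.
  absurd t< | no 1≮ux with ∃colour∉ 𝒢 u x [] (+-cancelʳ-< t 0 _
      (<-≤-trans t< (+-monoʳ-≤ (weight 𝒢 u x) (weight≤ 𝒢 v x))))
  ... | j , ux∈ , _ with ∃colour∉ 𝒢 v x (j ∷ []) (≤-trans (≤-trans (n≤1+n 2) t≥3)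
      (≤-pred (≤-trans t< (+-monoˡ-≤ (weight 𝒢 v x) (≮⇒≥ 1≮ux)))))
  ...   | k , vx∈ , k∉ = ¬distinct ux∈ vx∈ (k∉ ∘ here ∘ sym)

-- A pair of weight 3 leaves at most 3 for the other two by `weight-heavy`; without such a pair all
-- three weights are at most 2.
weight-triangle≤6 : (𝒢 : Fin 3 → Graph n) → RainbowTriangleFree 𝒢 →
  ∀ x y z → weight 𝒢 x y + weight 𝒢 x z + weight 𝒢 y z ≤ 6
weight-triangle≤6 𝒢 free x y z with 2 <? w x y | 2 <? w x z | 2 <? w y z
  where w = weight 𝒢
... | yes 2<xy | _ | _ = begin
  w x y + w x z + w y z     ≡⟨ +-assoc (w x y) _ _ ⟩
  w x y + (w x z + w y z)   ≤⟨ +-mono-≤ (weight≤ 𝒢 x y) (weight-heavy 𝒢 ≤-refl free x y z 2<xy) ⟩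
  6                         ∎
  where
  open ≤-Reasoning
  w = weight 𝒢
... | no _ | yes 2<xz | _ = begin
  w x y + w x z + w y z     ≡⟨ cong (w x y + w x z +_) (cong length (colours-comm 𝒢 y z)) ⟩
  w x y + w x z + w z y     ≡⟨ solve 3 (λ a b c → a :+ b :+ c := b :+ (a :+ c)) refl (w x y) (w x z) (w z y) ⟩
  w x z + (w x y + w z y)   ≤⟨ +-mono-≤ (weight≤ 𝒢 x z) (weight-heavy 𝒢 ≤-refl free x z y 2<xz) ⟩
  6                         ∎
  where
  open ≤-Reasoning
  w = weight 𝒢
... | no _ | no _ | yes 2<yz = begin
  w x y + w x z + w y z     ≡⟨ cong₂ (λ a b → a + b + w y z) (cong length (colours-comm 𝒢 x y)) (cong length (colours-comm 𝒢 x z)) ⟩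
  w y x + w z x + w y z     ≤⟨ +-mono-≤ (weight-heavy 𝒢 ≤-refl free y z x 2<yz) (weight≤ 𝒢 y z) ⟩
  6                         ∎
  where
  open ≤-Reasoning
  w = weight 𝒢
... | no xy≤2 | no xz≤2 | no yz≤2 = +-mono-≤ (+-mono-≤ (≮⇒≥ xy≤2) (≮⇒≥ xz≤2)) (≮⇒≥ yz≤2)

-- Counting edges by pairs of vertices, and the two bounds

edgeList : List (Fin n) → List (Subset n)
edgeList []       = []
edgeList (x ∷ xs) = map (edge x) xs ++ edgeList xs

∈-edgeList : {xs : List (Fin n)} {x y : Fin n} → x ∈ xs → y ∈ xs → x ≢ y → edge x y ∈ edgeList xs
∈-edgeList (here refl) (here refl) x≢y = contradiction refl x≢y
∈-edgeList (here refl) (there y∈)  x≢y = ∈-++⁺ˡ (∈-map⁺ (edge _) y∈)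
∈-edgeList {xs = y ∷ ys} {x} (there x∈) (here refl) x≢y =
  subst (_∈ edgeList (y ∷ ys)) (edge-comm y x) (∈-++⁺ˡ (∈-map⁺ (edge y) x∈))
∈-edgeList {xs = z ∷ zs} (there x∈) (there y∈) x≢y = ∈-++⁺ʳ (map (edge z) zs) (∈-edgeList x∈ y∈ x≢y)

sum-edgeList : (f : Subset n → ℕ) (xs : List (Fin n)) →
  listSum (map f (edgeList xs)) ≡ pairSum (λ x y → f (edge x y)) xs
sum-edgeList f [] = refl
sum-edgeList f (x ∷ xs) = begin
  listSum (map f (map (edge x) xs ++ edgeList xs))
    ≡⟨ cong listSum (map-++ f (map (edge x) xs) (edgeList xs)) ⟩
  listSum (map f (map (edge x) xs) ++ map f (edgeList xs))
    ≡⟨ sum-++ (map f (map (edge x) xs)) (map f (edgeList xs)) ⟩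
  listSum (map f (map (edge x) xs)) + listSum (map f (edgeList xs))
    ≡⟨ cong₂ _+_ (cong listSum (sym (map-∘ xs))) (sum-edgeList f xs) ⟩
  listSum (map (λ y → f (edge x y)) xs) + pairSum (λ x y → f (edge x y)) xs ∎
  where open ≡.≡-Reasoning

-- Each edge of `G` joins two distinct vertices and so occurs in the list of all pairs. As `edges G`
-- has no repetitions, its length is at most the number of listed pairs lying in `G`.
size≤pairSum : (G : Graph n) → size G ≤ pairSum (λ x y → indicator (_∈ᴳ? G) (edge x y)) (allFin n)
size≤pairSum {n} G = begin
  size G                                                 ≤⟨ unique-⊆⇒length≤ (unique G) sub ⟩
  length (filter (_∈ᴳ? G) (edgeList (allFin n)))         ≡⟨ length-filter≡sum (_∈ᴳ? G) (edgeList (allFin n)) ⟩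
  listSum (map (indicator (_∈ᴳ? G)) (edgeList (allFin n))) ≡⟨ sum-edgeList (indicator (_∈ᴳ? G)) (allFin n) ⟩
  pairSum (λ x y → indicator (_∈ᴳ? G) (edge x y)) (allFin n) ∎
  where
  open ≤-Reasoning
  sub : ∀ {E} → E ∈ᴳ G → E ∈ filter (_∈ᴳ? G) (edgeList (allFin n))
  sub {E} E∈ with ∣p∣≡2⇒p≡edge E (All.lookup (pairs G) E∈)
  ... | x , y , refl = ∈-filter⁺ (_∈ᴳ? G)
    (∈-edgeList (∈-allFin x) (∈-allFin y) (∣edge∣≡2⇒≢ x y (All.lookup (pairs G) E∈))) E∈

-- Double counting of incidences between indices and pairs: the sum over indices is moved inside,
-- where it counts the colours of one pair.
sum-size≤pairSum-weight : (𝒢 : Fin t → Graph n) → sum (λ i → size (𝒢 i)) ≤ pairSum (weight 𝒢) (allFin n)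
sum-size≤pairSum-weight {t} {n} 𝒢 = begin
  sum (λ i → size (𝒢 i))                              ≤⟨ sum-mono-≤ (λ i → size≤pairSum (𝒢 i)) ⟩
  sum (λ i → pairSum (χ i) (allFin n))                ≡⟨ sum-pairSum-comm χ (allFin n) ⟩
  pairSum (λ x y → sum (λ i → χ i x y)) (allFin n)    ≡⟨ pairSum-cong sum-χ (allFin n) ⟩
  pairSum (weight 𝒢) (allFin n)                       ∎
  where
  open ≤-Reasoning
  χ : Fin t → Fin n → Fin n → ℕ
  χ i x y = indicator (_∈ᴳ? 𝒢 i) (edge x y)
  sum-χ : ∀ x y → sum (λ i → χ i x y) ≡ weight 𝒢 x y
  sum-χ x y = ≡.trans (sum≡listSum (λ i → χ i x y))
    (≡.trans (cong listSum (sym (map-tabulate id (λ i → χ i x y))))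
      (sym (length-filter≡sum (λ i → edge x y ∈ᴳ? 𝒢 i) (allFin t))))

-- For n = 2 three copies of the single edge are rainbow triangle-free with total 3 > 2, so that
-- case is excluded. For n at most 1 there are no pairs.
sum-size≤n[n∸1] : (n : ℕ) → n ≢ 2 → (𝒢 : Fin 3 → Graph n) → RainbowTriangleFree 𝒢 →
  sum (λ i → size (𝒢 i)) ≤ n * (n ∸ 1)
sum-size≤n[n∸1] 0 _ 𝒢 _ = sum-size≤pairSum-weight 𝒢
sum-size≤n[n∸1] 1 _ 𝒢 _ = sum-size≤pairSum-weight 𝒢
sum-size≤n[n∸1] 2 2≢2 = contradiction refl 2≢2
sum-size≤n[n∸1] n@(suc (suc (suc m))) _ 𝒢 free = ≤-trans (sum-size≤pairSum-weight 𝒢)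
  -- The averaging bound carries the factor `suc m`, which is n - 2 and positive, so it can be
  -- cancelled.
  (*-cancelˡ-≤ (suc m) (subst (suc m * pairSum (weight 𝒢) (allFin n) ≤_) (*-comm (n * (2 + m)) (suc m))
    (pairSum-triangle≤6 (weight 𝒢) (weight-triangle≤6 𝒢 free) (suc m) (allFin n) (length-tabulate id))))

theorem1p4 : (t n : ℕ) → t ≥ 3 → (t ≡ 3 → n ≢ 2) →
    (𝒢 : Fin t → Graph n) → RainbowTriangleFree 𝒢 →
    (t ≡ 3 × sum (λ i → size (𝒢 i)) ≤ n * (n ∸ 1)) ⊎
    (t ≥ 4 × sum (λ i → size (𝒢 i)) ≤ t * (n ^ 2 / 4))
theorem1p4 t n t≥3 n≢2 𝒢 free with m≤n⇒m<n∨m≡n t≥3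
... | inj₂ refl = inj₁ (refl , sum-size≤n[n∸1] n (n≢2 refl) 𝒢 free)
... | inj₁ t≥4 = inj₂ (t≥4 , (begin
  sum (λ i → size (𝒢 i))               ≤⟨ sum-size≤pairSum-weight 𝒢 ⟩
  pairSum (weight 𝒢) (allFin n)        ≤⟨ pairSum-mantel t≥4 (weight 𝒢)
                                            (λ x y → cong length (colours-comm 𝒢 x y)) (weight≤ 𝒢)
                                            (weight-heavy 𝒢 t≥3 free) (allFin n) ⟩
  t * (length (allFin n) ^ 2 / 4)      ≡⟨ cong (λ k → t * (k ^ 2 / 4)) (length-tabulate {n = n} id) ⟩
  t * (n ^ 2 / 4)                      ∎))
  where open ≤-Reasoning
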